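{- Let $\mathcal M$ be a first-order structure and let $G$ be a topological group which is definable in $\mathcal M$ and has a basis for its topology consisting of sets definable in $\mathcal M$. Then the quotient $S^\mu_G(M)$ is a compact Hausdorff space on which the group $G(M)$ acts continuously. The map $g\mapsto \mathrm{tp}(g/M)_\mu$ embeds $G(M)$ as a dense subset of $S^\mu_G(M)$.
   Context: $M$ is the universe of $\mathcal M$; "definable" means definable with parameters from $M$; $\mathbb U$ is a sufficiently saturated elementary extension of $\mathcal M$. Topological groups are assumed Hausdorff; the topology on $G$ is a topology on $G(M)$. $S_G(M)$ is the space of complete types over $M$ containing the formula $x\in G$, with its usual logic topology. The infinitesimal type $\mu$ is the partial type over $M$ consisting of all formulas over $M$ that define open neighborhoods of the identity $e$ in $G(M)$. For $G$-formulas $\varphi,\psi$ over $M$, $\varphi\cdot\psi$ is the formula defining $\{ab:\varphi(a),\psi(b)\}$; for $p\in S_G(M)$, $\mu\cdot p=\{\varphi\cdot\psi:\mu\vdash\varphi,\ p\vdash\psi\}$. Write $p\sim_\mu q$ if $\mu\cdot p$ and $\mu\cdot q$ are logically equivalent partial types; $p_\mu$ denotes the $\sim_\mu$-class of $p$, and $S^\mu_G(M)=S_G(M)/{\sim_\mu}$ with the quotient topology. The group $G(M)$ acts on $S_G(M)$ by left translation, this action preserves $\sim_\mu$, and $G(M)$ acts on $S_G^\mu(M)$ by $g\cdot p_\mu=(g\cdot p)_\mu$. The action is continuous if the map $(g,p_\mu)\mapsto g\cdot p_\mu$ from $G(M)\times S^\mu_G(M)$ to $S_G^\mu(M)$ is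 continuous. "Embeds" means as a topological embedding. -}

module Defs where

open import Level using (Level; _⊔_) renaming (suc to lsuc)
open import Algebra.Structures using (IsGroup)
open import Axiom.ExcludedMiddle using (ExcludedMiddle)
open import Data.Empty using (⊥-elim)
open import Data.Fin using (Fin; zero; suc; _↑ˡ_; _↑ʳ_)
open import Data.List using (List; []; _∷_)
import Data.List as List
open import Data.List.Relation.Unary.All using (All; []; _∷_)
import Data.List.Relation.Unary.All as All
import Data.List.Relation.Unary.All.Properties as All
open import Data.List.Relation.Unary.Any using (Any)
open import Data.Nat using (ℕ; zero; suc; _+_)
open import Data.Product
  using (∃; ∃₂; Σ-syntax; _×_; _,_; proj₁; proj₂; uncurry)
open import Data.Product.Relation.Binary.Pointwise.NonDependent using (_×ₛ_)
open import Data.Sum using (_⊎_; inj₁; inj₂)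
open import Data.Unit.Polymorphic using (⊤)
open import Data.Vec using (Vec; []; _∷_; _++_; lookup; map; tabulate)
open import Data.Vec.Properties
  using (map-++; map-∘; map-cong; map-id; lookup-map; tabulate-cong;
         lookup-++ˡ; lookup-++ʳ; tabulate∘lookup; tabulate-∘)
open import Function using (id; _∘_; _⇔_; mk⇔; Equivalence)
open import Function.Definitions using (Congruent; Injective)
open import Relation.Binary
  using (Setoid; IsEquivalence; Rel; _Respects_)
open import Relation.Binary.PropositionalEquality
  using (_≡_; refl; sym; trans; cong; cong₂; subst; module ≡-Reasoning)
open import Relation.Nullary using (¬_; yes; no)
open import Relation.Unary
  using (Pred; _∈_; _⊆_; _∩_; _≐_; ⋃; _⊥_; Satisfiable; _⟨×⟩_)

open Equivalence using (to; from)

private variable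
  a c c′ e e′ o ℓ : Level
  k m n : ℕ

------------------------------------------------------------------------
-- Topology

-- The points form a setoid, so that quotient spaces are available.  A
-- subset is a predicate at a fixed level o; by predicativity, families of
-- subsets live one universe higher.

record Topology (X : Setoid c e) (o : Level)
  : Set (lsuc (c ⊔ e ⊔ lsuc o)) where
  open Setoid X
  field
    Open          : Pred (Pred Carrier o) (c ⊔ e ⊔ lsuc o)
    open-respects : ∀ {V} → Open V → V Respects _≈_
    open-whole    : Open (λ _ → ⊤)
    open-∩        : ∀ {V W} → Open V → Open W → Open (V ∩ W)
    -- The union of F is itself a predicate at too high a level, hence the
    -- copy W of it at level o.  This field also makes Open extensional.
    open-⋃        : (F : Pred (Pred Carrier o) (c ⊔ e ⊔ lsuc o)) → F ⊆ Open →
                    ∀ {W} → W ≐ ⋃ (∃ F) proj₁ → Open W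

open Topology using (Open)

module _ {X : Setoid c e} (τ : Topology X o) where
  open Setoid X

  Hausdorff : Set (c ⊔ e ⊔ lsuc o)
  Hausdorff = ∀ x y → ¬ x ≈ y →
    ∃₂ λ V W → Open τ V × Open τ W × x ∈ V × y ∈ W × V ⊥ W

  Compact : Set (lsuc (c ⊔ e ⊔ lsuc o))
  Compact = (F : Pred (Pred Carrier o) (c ⊔ e ⊔ lsuc o)) → F ⊆ Open τ →
    (∀ x → x ∈ ⋃ (∃ F) proj₁) →
    Σ[ Vs ∈ List (Pred Carrier o) ] All F Vs × (∀ x → Any (x ∈_) Vs)

module _ {X : Setoid c e} {Y : Setoid c′ e′} where
  private
    module X = Setoid X
    module Y = Setoid Y

  _×ᵗ_ : Topology X o → Topology Y o → Topology (X ×ₛ Y) o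
  _×ᵗ_ {o = o} σ τ = record
    { Open          = λ W →
        (W Respects Setoid._≈_ (X ×ₛ Y)) × (∀ {z} → z ∈ W → Box W z)
    ; open-respects = proj₁
    ; open-whole    = (λ _ _ → _) , λ _ →
        (λ _ → ⊤) , (λ _ → ⊤) ,
        Topology.open-whole σ , Topology.open-whole τ , _ , λ _ → _
    ; open-∩        = λ (rV , oV) (rW , oW) →
        (λ eq (v , w) → rV eq v , rW eq w) ,
        λ (v , w) →
          let A  , B  , oA  , oB  , (a , b)   , sub  = oV v
              A′ , B′ , oA′ , oB′ , (a′ , b′) , sub′ = oW w
          in A ∩ A′ , B ∩ B′ ,
             Topology.open-∩ σ oA oA′ , Topology.open-∩ τ oB oB′ ,
             ((a , a′) , (b , b′)) ,
             λ ((x , x′) , (y , y′)) → sub (x , y) , sub′ (x′ , y′)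
    ; open-⋃        = λ F F⊆ (W⊆ , ⊆W) →
        (λ eq w → let (V , f) , v = W⊆ w
                  in ⊆W ((V , f) , proj₁ (F⊆ f) eq v)) ,
        λ w →
          let (V , f) , v = W⊆ w
              A , B , oA , oB , ab , sub = proj₂ (F⊆ f) v
          in A , B , oA , oB , ab , λ z → ⊆W ((V , f) , sub z)
    }
    where
    Box : Pred (X.Carrier × Y.Carrier) o → Pred (X.Carrier × Y.Carrier) _
    Box W z = ∃₂ λ A B →
      Open σ A × Open τ B × z ∈ (A ⟨×⟩ B) × (A ⟨×⟩ B) ⊆ W

  module _ (σ : Topology X o) (τ : Topology Y o)
           (f : X.Carrier → Y.Carrier) where

    record IsContinuous : Set (c ⊔ e ⊔ c′ ⊔ e′ ⊔ lsuc o) where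
      field
        congruent     : Congruent X._≈_ Y._≈_ f
        preimage-open : ∀ {V} → Open τ V → Open σ (V ∘ f)

    record IsEmbedding : Set (c ⊔ e ⊔ c′ ⊔ e′ ⊔ lsuc o) where
      field
        isContinuous : IsContinuous
        injective    : Injective X._≈_ Y._≈_ f
        inducing     : ∀ {V} → Open σ V → ∃ λ W → Open τ W × V ≐ (W ∘ f)

    HasDenseImage : Set (c ⊔ c′ ⊔ e′ ⊔ lsuc o)
    HasDenseImage = ∀ {V} → Open τ V → Satisfiable V → ∃ λ x → f x ∈ V

module _ {X : Setoid c e} (τ : Topology X o)
         {_∼_ : Rel (Setoid.Carrier X) (c ⊔ e ⊔ lsuc o)}
         (isEq : IsEquivalence _∼_) where

  Quotient : Setoid c (c ⊔ e ⊔ lsuc o)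
  Quotient = record { isEquivalence = isEq }

  -- Subsets of the quotient are the ∼-invariant subsets of X, so taking
  -- preimages along the projection changes nothing.
  quotientTopology : Topology Quotient o
  quotientTopology = record
    { Open          = λ V → (V Respects _∼_) × Open τ V
    ; open-respects = proj₁
    ; open-whole    = (λ _ _ → _) , Topology.open-whole τ
    ; open-∩        = λ (rV , oV) (rW , oW) →
        (λ eq (v , w) → rV eq v , rW eq w) , Topology.open-∩ τ oV oW
    ; open-⋃        = λ F F⊆ (W⊆ , ⊆W) →
        (λ eq w → let (V , f) , v = W⊆ w
                  in ⊆W ((V , f) , proj₁ (F⊆ f) eq v)) ,
        Topology.open-⋃ τ F (proj₂ ∘ F⊆) (W⊆ , ⊆W)
    }

module _ {X : Setoid c e} {Y : Setoid c′ e′}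
         (σ : Topology X o) (τ : Topology Y o) where
  private
    module X = Setoid X
    module Y = Setoid Y

  record IsContinuousAction (_∙_ : X.Carrier → X.Carrier → X.Carrier)
    (ε : X.Carrier) (_▷_ : X.Carrier → Y.Carrier → Y.Carrier)
    : Set (c ⊔ e ⊔ c′ ⊔ e′ ⊔ lsuc o) where
    field
      identity     : ∀ y → (ε ▷ y) Y.≈ y
      compatible   : ∀ g h y → ((g ∙ h) ▷ y) Y.≈ (g ▷ (h ▷ y))
      isContinuous : IsContinuous (σ ×ᵗ τ) τ (uncurry _▷_)

------------------------------------------------------------------------
-- First-order logic

record Language (ℓ : Level) : Set (lsuc ℓ) where
  field
    Funs : ℕ → Set ℓ
    Rels : ℕ → Set ℓ

record Structure (L : Language ℓ) : Set (lsuc ℓ) where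
  private module L = Language L
  field
    Universe : Set ℓ
    ⟦fun⟧    : L.Funs k → Vec Universe k → Universe
    ⟦rel⟧    : L.Rels k → Pred (Vec Universe k) ℓ

open Structure using (Universe; ⟦fun⟧; ⟦rel⟧)

module _ (L : Language ℓ) (C : Set ℓ) where
  private module L = Language L

  -- Terms and formulas with n free variables (de Bruijn indices) in the
  -- language L expanded by a constant for each element of C.

  data Term (n : ℕ) : Set ℓ where
    var   : Fin n → Term n
    const : C → Term n
    fun   : L.Funs k → (Fin k → Term n) → Term n

  infix  9 _≐′_
  infixr 8 ¬′_
  infixr 7 _∧′_
  infixr 6 ∃′_

  data Formula (n : ℕ) : Set ℓ where
    _≐′_ : Term n → Term n → Formula n
    rel  : L.Rels k → (Fin k → Term n) → Formula n
    ¬′_  : Formula n → Formula n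
    _∧′_ : Formula n → Formula n → Formula n
    ∃′_  : Formula (suc n) → Formula n

module _ {L : Language ℓ} {C : Set ℓ} (𝓝 : Structure L)
         (ι : C → Universe 𝓝) where

  eval : Term L C n → Vec (Universe 𝓝) n → Universe 𝓝
  eval (var i)    v = lookup v i
  eval (const x)  v = ι x
  eval (fun f ts) v = ⟦fun⟧ 𝓝 f (tabulate λ i → eval (ts i) v)

  Sat : Formula L C n → Pred (Vec (Universe 𝓝) n) ℓ
  Sat (s ≐′ t)   v = eval s v ≡ eval t v
  Sat (rel r ts) v = ⟦rel⟧ 𝓝 r (tabulate λ i → eval (ts i) v)
  Sat (¬′ φ)     v = ¬ Sat φ v
  Sat (φ ∧′ ψ)   v = Sat φ v × Sat ψ v
  Sat (∃′ φ)     v = ∃ λ x → Sat φ (x ∷ v)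

module _ {L : Language ℓ} {C : Set ℓ} where

  weaken : Term L C n → Term L C (suc n)
  weaken (var i)    = var (suc i)
  weaken (const x)  = const x
  weaken (fun f ts) = fun f (weaken ∘ ts)

  _[_]ᵗ : Term L C m → Vec (Term L C n) m → Term L C n
  var i    [ σ ]ᵗ = lookup σ i
  const x  [ σ ]ᵗ = const x
  fun f ts [ σ ]ᵗ = fun f λ i → ts i [ σ ]ᵗ

  lift : Vec (Term L C n) m → Vec (Term L C (suc n)) (suc m)
  lift σ = var zero ∷ map weaken σ

  infix 10 _[_]
  _[_] : Formula L C m → Vec (Term L C n) m → Formula L C n
  (s ≐′ t)   [ σ ] = (s [ σ ]ᵗ) ≐′ (t [ σ ]ᵗ)
  (rel r ts) [ σ ] = rel r λ i → ts i [ σ ]ᵗ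
  (¬′ φ)     [ σ ] = ¬′ φ [ σ ]
  (φ ∧′ ψ)   [ σ ] = φ [ σ ] ∧′ ψ [ σ ]
  (∃′ φ)     [ σ ] = ∃′ φ [ lift σ ]

  -- Quantifies away the first k variables.
  ∃^ : ∀ k → Formula L C (k + n) → Formula L C n
  ∃^ zero    φ = φ
  ∃^ (suc k) φ = ∃^ k (∃′ φ)

  consts : Vec C m → Vec (Term L C n) m
  consts = map const

module _ {L : Language ℓ} {C : Set ℓ} (𝓝 : Structure L)
         (ι : C → Universe 𝓝) where

  private
    ⟦_⟧ : Term L C n → Vec (Universe 𝓝) n → Universe 𝓝
    ⟦_⟧ = eval 𝓝 ι

  evals : Vec (Term L C n) m → Vec (Universe 𝓝) n → Vec (Universe 𝓝) m
  evals σ v = map (λ t → ⟦ t ⟧ v) σ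

  eval-weaken : ∀ (t : Term L C n) x v → ⟦ weaken t ⟧ (x ∷ v) ≡ ⟦ t ⟧ v
  eval-weaken (var i)    x v = refl
  eval-weaken (const _)  x v = refl
  eval-weaken (fun f ts) x v =
    cong (⟦fun⟧ 𝓝 f) (tabulate-cong λ i → eval-weaken (ts i) x v)

  eval-[] : ∀ (t : Term L C m) (σ : Vec (Term L C n) m) v →
            ⟦ t [ σ ]ᵗ ⟧ v ≡ ⟦ t ⟧ (evals σ v)
  eval-[] (var i)    σ v = sym (lookup-map i _ σ)
  eval-[] (const _)  σ v = refl
  eval-[] (fun f ts) σ v =
    cong (⟦fun⟧ 𝓝 f) (tabulate-cong λ i → eval-[] (ts i) σ v)

  evals-lift : ∀ (σ : Vec (Term L C n) m) x v →
               evals (lift σ) (x ∷ v) ≡ x ∷ evals σ v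
  evals-lift σ x v = cong (x ∷_)
    (trans (sym (map-∘ _ weaken σ)) (map-cong (λ t → eval-weaken t x v) σ))

  sat-[] : ∀ (φ : Formula L C m) (σ : Vec (Term L C n) m) v →
           Sat 𝓝 ι (φ [ σ ]) v ⇔ Sat 𝓝 ι φ (evals σ v)
  sat-[] (s ≐′ t)   σ v = mk⇔
    (λ eq → trans (sym (eval-[] s σ v)) (trans eq (eval-[] t σ v)))
    (λ eq → trans (eval-[] s σ v) (trans eq (sym (eval-[] t σ v))))
  sat-[] (rel r ts) σ v = mk⇔ (subst (⟦rel⟧ 𝓝 r) eq) (subst (⟦rel⟧ 𝓝 r) (sym eq))
    where eq = tabulate-cong λ i → eval-[] (ts i) σ v
  sat-[] (¬′ φ)     σ v = mk⇔ (_∘ from (sat-[] φ σ v)) (_∘ to (sat-[] φ σ v))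
  sat-[] (φ ∧′ ψ)   σ v = mk⇔
    (λ (p , q) → to (sat-[] φ σ v) p , to (sat-[] ψ σ v) q)
    (λ (p , q) → from (sat-[] φ σ v) p , from (sat-[] ψ σ v) q)
  sat-[] (∃′ φ)     σ v = mk⇔
    (λ (x , p) → x , subst (Sat 𝓝 ι φ) (evals-lift σ x v)
                       (to (sat-[] φ (lift σ) (x ∷ v)) p))
    (λ (x , p) → x , from (sat-[] φ (lift σ) (x ∷ v))
                       (subst (Sat 𝓝 ι φ) (sym (evals-lift σ x v)) p))

  sat-∃^ : ∀ k (φ : Formula L C (k + n)) v →
           Sat 𝓝 ι (∃^ k φ) v ⇔ (∃ λ w → Sat 𝓝 ι φ (w ++ v))
  sat-∃^ zero    φ v = mk⇔ ([] ,_) λ { ([] , p) → p }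
  sat-∃^ (suc k) φ v = mk⇔
    (λ p → let w , x , q = to (sat-∃^ k (∃′ φ) v) p in x ∷ w , q)
    λ { (x ∷ w , q) → from (sat-∃^ k (∃′ φ) v) (w , x , q) }

  evals-consts : ∀ (xs : Vec C m) (v : Vec (Universe 𝓝) n) →
                 evals (consts xs) v ≡ map ι xs
  evals-consts xs v = sym (map-∘ _ const xs)

  evals-vars : ∀ (f : Fin m → Fin n) (v : Vec (Universe 𝓝) n) w →
               (∀ i → lookup v (f i) ≡ lookup w i) →
               evals (tabulate (var ∘ f)) v ≡ w
  evals-vars f v w eq = trans (sym (tabulate-∘ _ (var ∘ f)))
    (trans (tabulate-cong eq) (tabulate∘lookup w))

-- Formulas with parameters from the structure.

Formulaᴹ : {L : Language ℓ} → Structure L → ℕ → Set ℓ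
Formulaᴹ {L = L} 𝓜 = Formula L (Universe 𝓜)

module _ {L : Language ℓ} where

  infix 4 _⊨_
  _⊨_ : (𝓜 : Structure L) → Formulaᴹ 𝓜 n → Pred (Vec (Universe 𝓜) n) ℓ
  𝓜 ⊨ φ = Sat 𝓜 id φ

  record ElementaryExtension (𝓜 : Structure L) : Set (lsuc ℓ) where
    field
      𝓤          : Structure L
      embed      : Universe 𝓜 → Universe 𝓤

    ⊨ᵁ : Formulaᴹ 𝓜 n → Pred (Vec (Universe 𝓤) n) ℓ
    ⊨ᵁ φ = Sat 𝓤 embed φ

    field
      elementary : (φ : Formulaᴹ 𝓜 n) (v : Vec (Universe 𝓜) n) →
                   (𝓜 ⊨ φ) v ⇔ ⊨ᵁ φ (map embed v)

    Realizes : Vec (Universe 𝓤) n → Pred (Formulaᴹ 𝓜 n) a → Set (ℓ ⊔ a)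
    Realizes v Φ = ∀ {φ} → φ ∈ Φ → v ∈ ⊨ᵁ φ

    _⊢_ : Pred (Formulaᴹ 𝓜 n) a → Formulaᴹ 𝓜 n → Set (ℓ ⊔ a)
    Φ ⊢ φ = ∀ v → Realizes v Φ → v ∈ ⊨ᵁ φ

    LogicallyEquivalent : Rel (Pred (Formulaᴹ 𝓜 n) a) (ℓ ⊔ a)
    LogicallyEquivalent Φ Ψ = ∀ v → Realizes v Φ ⇔ Realizes v Ψ

    -- "Sufficiently saturated": partial types over 𝓜 in finitely many
    -- variables are realized.  Every |M|⁺-saturated 𝓤 (|M| + |L| for
    -- large L) has this property.
    Saturated : Set (lsuc ℓ)
    Saturated = ∀ {n} (Φ : Pred (Formulaᴹ 𝓜 n) ℓ) →
      (∀ φs → All Φ φs → ∃ λ v → All (λ φ → v ∈ ⊨ᵁ φ) φs) →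
      ∃ λ v → Realizes v Φ

------------------------------------------------------------------------
-- Definable topological groups

module _ {L : Language ℓ} where

  -- The solution set of γ; tuples are compared, not the proofs that they
  -- satisfy γ.
  Solutions : (𝓜 : Structure L) → Formulaᴹ 𝓜 n → Setoid ℓ ℓ
  Solutions 𝓜 γ = record
    { Carrier       = ∃ (𝓜 ⊨ γ)
    ; _≈_           = λ x y → proj₁ x ≡ proj₁ y
    ; isEquivalence = record { refl = refl ; sym = sym ; trans = trans }
    }

  record DefinableGroup (𝓜 : Structure L) : Set (lsuc ℓ) where
    infixl 7 _∙_
    field
      {dim}    : ℕ
      γ        : Formulaᴹ 𝓜 dim
    Gᴹ : Setoid ℓ ℓ
    Gᴹ = Solutions 𝓜 γ
    open Setoid Gᴹ public
      using (_≈_) renaming (Carrier to G)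
    field
      _∙_      : G → G → G
      ε        : G
      _⁻¹      : G → G
      isGroup  : IsGroup _≈_ _∙_ ε _⁻¹
      -- The graph of multiplication is definable; hence so is that of ⁻¹.
      mult     : Formulaᴹ 𝓜 (dim + (dim + dim))
      mult-def : ∀ x y z → (𝓜 ⊨ mult) (x ++ (y ++ z)) ⇔
                 (∃₂ λ x∈G y∈G → proj₁ ((x , x∈G) ∙ (y , y∈G)) ≡ z)

  record DefinableTopologicalGroup (𝓜 : Structure L) : Set (lsuc (lsuc ℓ)) where
    field
      definableGroup : DefinableGroup 𝓜
    open DefinableGroup definableGroup public
    field
      topology       : Topology Gᴹ ℓ
      hausdorff      : Hausdorff topology
      ∙-continuous   : IsContinuous (topology ×ᵗ topology) topology (uncurry _∙_)
      ⁻¹-continuous  : IsContinuous topology topology _⁻¹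

    -- The subset of G(M) defined by φ.
    ⟪_⟫ : Formulaᴹ 𝓜 dim → Pred G ℓ
    ⟪ φ ⟫ = (𝓜 ⊨ φ) ∘ proj₁

    IsGFormula : Pred (Formulaᴹ 𝓜 dim) ℓ
    IsGFormula φ = (𝓜 ⊨ φ) ⊆ (𝓜 ⊨ γ)

    field
      definable-basis : ∀ {V g} → Open topology V → g ∈ V →
        ∃ λ φ → IsGFormula φ × Open topology ⟪ φ ⟫ × g ∈ ⟪ φ ⟫ × ⟪ φ ⟫ ⊆ V

------------------------------------------------------------------------
-- Types

module Types {L : Language ℓ} {𝓜 : Structure L} (𝓖 : DefinableGroup 𝓜) where
  open DefinableGroup 𝓖
  open IsGroup isGroup using (∙-cong)

  -- Finite satisfiability in 𝓜 is consistency with the elementary diagram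
  -- of 𝓜.
  record S_G : Set (lsuc ℓ) where
    field
      formulas   : Pred (Formulaᴹ 𝓜 dim) ℓ
      consistent : ∀ {φs} → All formulas φs →
                   ∃ λ v → All (λ φ → (𝓜 ⊨ φ) v) φs
      complete   : ∀ φ → φ ∈ formulas ⊎ (¬′ φ) ∈ formulas
      γ∈         : γ ∈ formulas

    -- Deductive closure.
    entails : ∀ {φs ψ} → All formulas φs →
              (∀ v → All (λ φ → (𝓜 ⊨ φ) v) φs → (𝓜 ⊨ ψ) v) → ψ ∈ formulas
    entails {ψ = ψ} φs∈ h with complete ψ
    ... | inj₁ ψ∈  = ψ∈
    ... | inj₂ ¬ψ∈ with v , ¬ψ ∷ sat ← consistent (¬ψ∈ ∷ φs∈) = ⊥-elim (¬ψ (h v sat))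

  open S_G using (formulas; consistent; complete; γ∈; entails)

  S_G-setoid : Setoid (lsuc ℓ) ℓ
  S_G-setoid = record
    { Carrier       = S_G
    ; _≈_           = λ p q → formulas p ≐ formulas q
    ; isEquivalence = record
      { refl  = id , id
      ; sym   = λ (f , g) → g , f
      ; trans = λ (f , g) (f′ , g′) → f′ ∘ f , g ∘ g′
      }
    }

  logicTopology : Topology S_G-setoid ℓ
  logicTopology = record
    { Open          = λ V → ∀ {p} → p ∈ V →
        ∃ λ φ → φ ∈ formulas p × (λ q → φ ∈ formulas q) ⊆ V
    ; open-respects = λ oV (p⊆q , _) p∈ → let φ , φ∈ , sub = oV p∈ in sub (p⊆q φ∈)
    ; open-whole    = λ {p} _ → γ , γ∈ p , _
    ; open-∩        = λ oV oW {p} (v , w) →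
        let φ , φ∈ , sub  = oV v
            ψ , ψ∈ , sub′ = oW w
        in φ ∧′ ψ ,
           entails p (φ∈ ∷ ψ∈ ∷ []) (λ { _ (sφ ∷ sψ ∷ []) → sφ , sψ }) ,
           λ {q} χ∈ → sub  (entails q (χ∈ ∷ []) λ { _ ((sφ , _) ∷ []) → sφ }) ,
                      sub′ (entails q (χ∈ ∷ []) λ { _ ((_ , sψ) ∷ []) → sψ })
    ; open-⋃        = λ F F⊆ (W⊆ , ⊆W) w →
        let (V , f) , v    = W⊆ w
            φ , φ∈ , sub = F⊆ f v
        in φ , φ∈ , λ q∈ → ⊆W ((V , f) , sub q∈)
    }

  tp : ExcludedMiddle ℓ → G → S_G
  tp em (v , v∈G) = record
    { formulas   = λ φ → (𝓜 ⊨ φ) v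
    ; consistent = v ,_
    ; complete   = em⇒⊎
    ; γ∈         = v∈G
    }
    where
    em⇒⊎ : ∀ φ → (𝓜 ⊨ φ) v ⊎ (𝓜 ⊨ ¬′ φ) v
    em⇒⊎ φ with em {(𝓜 ⊨ φ) v}
    ... | yes p = inj₁ p
    ... | no ¬p = inj₂ ¬p

  module Product where
    x y z : Vec (Term L (Universe 𝓜) (dim + (dim + dim))) dim
    y = tabulate λ i → var (i ↑ˡ (dim + dim))
    x = tabulate λ i → var (dim ↑ʳ (i ↑ˡ dim))
    z = tabulate λ i → var (dim ↑ʳ (dim ↑ʳ i))

    matrix : Formulaᴹ 𝓜 dim → Formulaᴹ 𝓜 dim → Formulaᴹ 𝓜 (dim + (dim + dim))
    matrix φ ψ = φ [ x ] ∧′ ψ [ y ] ∧′ mult [ x ++ (y ++ z) ]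

  module Translate (g : G) where
    x y : Vec (Term L (Universe 𝓜) (dim + dim)) dim
    y = tabulate λ i → var (i ↑ˡ dim)
    x = tabulate λ i → var (dim ↑ʳ i)

    matrix : Formulaᴹ 𝓜 dim → Formulaᴹ 𝓜 (dim + dim)
    matrix φ = mult [ consts (proj₁ g) ++ (x ++ y) ] ∧′ φ [ y ]

  -- φ · ψ is the formula  ∃x ∃y (φ(x) ∧ ψ(y) ∧ x ∙ y = z)  in z.  The
  -- context of its matrix is y ++ (x ++ z).
  infixl 7 _·_
  _·_ : Formulaᴹ 𝓜 dim → Formulaᴹ 𝓜 dim → Formulaᴹ 𝓜 dim
  φ · ψ = ∃^ dim (∃^ dim (Product.matrix φ ψ))

  -- φ ⟨ g ∙x⟩ is the formula  ∃y (g ∙ x = y ∧ φ(y)),  i.e. φ(g ∙ x),  in x.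
  _⟨_∙x⟩ : Formulaᴹ 𝓜 dim → G → Formulaᴹ 𝓜 dim
  φ ⟨ g ∙x⟩ = ∃^ dim (Translate.matrix g φ)

  evals-++₃ : ∀ {k l m n} (ρ : Vec (Term L (Universe 𝓜) n) k)
    (σ : Vec (Term L (Universe 𝓜) n) l) (τ : Vec (Term L (Universe 𝓜) n) m) v →
    evals 𝓜 id (ρ ++ (σ ++ τ)) v ≡
    evals 𝓜 id ρ v ++ (evals 𝓜 id σ v ++ evals 𝓜 id τ v)
  evals-++₃ ρ σ τ v = trans (map-++ ⟦_⟧ ρ (σ ++ τ))
    (cong (evals 𝓜 id ρ v ++_) (map-++ ⟦_⟧ σ τ))
    where
    ⟦_⟧ = λ t → eval 𝓜 id t v

  sat-· : ∀ φ ψ z → (𝓜 ⊨ φ · ψ) z ⇔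
    (∃₂ λ (x y : G) → (𝓜 ⊨ φ) (proj₁ x) × (𝓜 ⊨ ψ) (proj₁ y) × proj₁ (x ∙ y) ≡ z)
  sat-· φ ψ z = mk⇔
    (λ s → let x , s₁ = to (sat-∃^ 𝓜 id dim (∃^ dim (Product.matrix φ ψ)) z) s
               y , sφ , sψ , sm = to (sat-∃^ 𝓜 id dim (Product.matrix φ ψ) (x ++ z)) s₁
               x∈G , y∈G , eq = to (mult-def x y z)
                 (subst (𝓜 ⊨ mult) (mult-eq x y) (to (sat-[] 𝓜 id mult xyz (y ++ (x ++ z))) sm))
           in (x , x∈G) , (y , y∈G) ,
              subst (𝓜 ⊨ φ) (x-eq x y) (to (sat-[] 𝓜 id φ Product.x (y ++ (x ++ z))) sφ) ,
              subst (𝓜 ⊨ ψ) (y-eq x y) (to (sat-[] 𝓜 id ψ Product.y (y ++ (x ++ z))) sψ) ,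
              eq)
    (λ ((x , x∈G) , (y , y∈G) , sφ , sψ , eq) →
      from (sat-∃^ 𝓜 id dim (∃^ dim (Product.matrix φ ψ)) z) (x ,
        from (sat-∃^ 𝓜 id dim (Product.matrix φ ψ) (x ++ z)) (y ,
          from (sat-[] 𝓜 id φ Product.x (y ++ (x ++ z))) (subst (𝓜 ⊨ φ) (sym (x-eq x y)) sφ) ,
          from (sat-[] 𝓜 id ψ Product.y (y ++ (x ++ z))) (subst (𝓜 ⊨ ψ) (sym (y-eq x y)) sψ) ,
          from (sat-[] 𝓜 id mult xyz (y ++ (x ++ z))) (subst (𝓜 ⊨ mult) (sym (mult-eq x y))
            (from (mult-def x y z) (x∈G , y∈G , eq))))))
    where
    xyz = Product.x ++ (Product.y ++ Product.z)
    module _ (x y : Vec (Universe 𝓜) dim) where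
      y-eq : evals 𝓜 id Product.y (y ++ (x ++ z)) ≡ y
      y-eq = evals-vars 𝓜 id _ (y ++ (x ++ z)) y (lookup-++ˡ y (x ++ z))
      x-eq : evals 𝓜 id Product.x (y ++ (x ++ z)) ≡ x
      x-eq = evals-vars 𝓜 id _ (y ++ (x ++ z)) x λ i →
        trans (lookup-++ʳ y (x ++ z) _) (lookup-++ˡ x z i)
      z-eq : evals 𝓜 id Product.z (y ++ (x ++ z)) ≡ z
      z-eq = evals-vars 𝓜 id _ (y ++ (x ++ z)) z λ i →
        trans (lookup-++ʳ y (x ++ z) _) (lookup-++ʳ x z i)
      mult-eq : evals 𝓜 id xyz (y ++ (x ++ z)) ≡ x ++ (y ++ z)
      mult-eq = trans (evals-++₃ Product.x Product.y Product.z (y ++ (x ++ z)))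
        (cong₂ _++_ x-eq (cong₂ _++_ y-eq z-eq))

  sat-∙x : ∀ φ g x (x∈G : (𝓜 ⊨ γ) x) →
    (𝓜 ⊨ φ ⟨ g ∙x⟩) x ⇔ (𝓜 ⊨ φ) (proj₁ (g ∙ (x , x∈G)))
  sat-∙x φ g x x∈G = mk⇔
    (λ s → let y , sm , sφ = to (sat-∃^ 𝓜 id dim (Translate.matrix g φ) x) s
               _ , _ , eq = to (mult-def (proj₁ g) x y)
                 (subst (𝓜 ⊨ mult) (mult-eq y) (to (sat-[] 𝓜 id mult gxy (y ++ x)) sm))
           in subst (𝓜 ⊨ φ) (trans (y-eq y) (trans (sym eq) (∙-cong refl refl)))
                (to (sat-[] 𝓜 id φ (Translate.y g) (y ++ x)) sφ))
    (λ sφ → let y = proj₁ (g ∙ (x , x∈G)) in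
      from (sat-∃^ 𝓜 id dim (Translate.matrix g φ) x) (y ,
        from (sat-[] 𝓜 id mult gxy (y ++ x)) (subst (𝓜 ⊨ mult) (sym (mult-eq y))
          (from (mult-def (proj₁ g) x y) (proj₂ g , x∈G , refl))) ,
        from (sat-[] 𝓜 id φ (Translate.y g) (y ++ x)) (subst (𝓜 ⊨ φ) (sym (y-eq y)) sφ)))
    where
    gxy = consts (proj₁ g) ++ (Translate.x g ++ Translate.y g)
    module _ (y : Vec (Universe 𝓜) dim) where
      y-eq : evals 𝓜 id (Translate.y g) (y ++ x) ≡ y
      y-eq = evals-vars 𝓜 id _ (y ++ x) y (lookup-++ˡ y x)
      x-eq : evals 𝓜 id (Translate.x g) (y ++ x) ≡ x
      x-eq = evals-vars 𝓜 id _ (y ++ x) x (lookup-++ʳ y x)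
      mult-eq : evals 𝓜 id gxy (y ++ x) ≡ proj₁ g ++ (x ++ y)
      mult-eq = trans (evals-++₃ (consts (proj₁ g)) (Translate.x g) (Translate.y g) (y ++ x))
        (cong₂ _++_ (trans (evals-consts 𝓜 id (proj₁ g) (y ++ x)) (map-id (proj₁ g)))
                    (cong₂ _++_ x-eq y-eq))

  -- g ▷ tp(x/M) = tp(g ∙ x/M).
  infixr 6 _▷_
  _▷_ : G → S_G → S_G
  g ▷ p = record
    { formulas   = λ φ → φ ⟨ g ∙x⟩ ∈ formulas p
    ; consistent = ▷-consistent
    ; complete   = ▷-complete
    ; γ∈         = entails p (γ∈ p ∷ []) λ { x (x∈G ∷ []) →
        from (sat-∙x γ g x x∈G) (proj₂ (g ∙ (x , x∈G))) }
    }
    where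
    ▷-consistent : ∀ {φs} → All (λ φ → φ ⟨ g ∙x⟩ ∈ formulas p) φs →
                   ∃ λ v → All (λ φ → (𝓜 ⊨ φ) v) φs
    ▷-consistent φs∈
      with x , x∈G ∷ sat ← consistent p (γ∈ p ∷ All.map⁺ {f = _⟨ g ∙x⟩} φs∈) =
      proj₁ (g ∙ (x , x∈G)) ,
      All.map (λ {φ} → to (sat-∙x φ g x x∈G)) (All.map⁻ sat)

    ▷-complete : ∀ φ → φ ⟨ g ∙x⟩ ∈ formulas p ⊎ (¬′ φ) ⟨ g ∙x⟩ ∈ formulas p
    ▷-complete φ with complete p (φ ⟨ g ∙x⟩)
    ... | inj₁ φ∈  = inj₁ φ∈
    ... | inj₂ ¬φ∈ = inj₂ (entails p (γ∈ p ∷ ¬φ∈ ∷ []) λ { x (x∈G ∷ ¬s ∷ []) →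
      from (sat-∙x (¬′ φ) g x x∈G) (¬s ∘ from (sat-∙x φ g x x∈G)) })

------------------------------------------------------------------------
-- The space of μ-types

module μTypes {L : Language ℓ} {𝓜 : Structure L}
              (𝓖 : DefinableTopologicalGroup 𝓜)
              (𝓔 : ElementaryExtension 𝓜) where
  open DefinableTopologicalGroup 𝓖
  open ElementaryExtension 𝓔
  open Types definableGroup
  open S_G using (formulas)

  μ : Pred (Formulaᴹ 𝓜 dim) (lsuc ℓ)
  μ φ = IsGFormula φ × Open topology ⟪ φ ⟫ × ε ∈ ⟪ φ ⟫

  -- χ ≡ φ · ψ is identity of formulas; formulas that are merely equivalent
  -- are identified only through LogicallyEquivalent.
  μ·_ : S_G → Pred (Formulaᴹ 𝓜 dim) (lsuc ℓ)
  (μ· p) χ = ∃₂ λ φ ψ →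
    IsGFormula φ × IsGFormula ψ × μ ⊢ φ × formulas p ⊢ ψ × χ ≡ φ · ψ

  _∼_ : Rel S_G (lsuc ℓ)
  p ∼ q = LogicallyEquivalent (μ· p) (μ· q)

  ∼-isEquivalence : IsEquivalence _∼_
  ∼-isEquivalence = record
    { refl  = λ _ → mk⇔ id id
    ; sym   = λ eq v → mk⇔ (from (eq v)) (to (eq v))
    ; trans = λ eq eq′ v → mk⇔ (to (eq′ v) ∘ to (eq v)) (from (eq v) ∘ from (eq′ v))
    }

  Sᵘ : Setoid (lsuc ℓ) (lsuc ℓ)
  Sᵘ = Quotient logicTopology ∼-isEquivalence

  Sᵘ-topology : Topology Sᵘ ℓ
  Sᵘ-topology = quotientTopology logicTopology ∼-isEquivalence

-- Write p ≲ q if U · ψ ∈ q for all definable neighbourhoods U of ε and all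
-- ψ ∈ p.  This relation is symmetric, and saturation identifies it with ∼.
-- Hence, for V ⊆ G(M), the set O V of types p with U · ψ ⊆ V for some U and
-- some ψ ∈ p is open and invariant; O V and O W are disjoint when V and W
-- are.  If U · ψ ∉ q with ψ ∈ p, and V⁻¹ V ⊆ U, then O (V · ψ) and
-- O (V · ¬(U · ψ)) separate p from q.  The ∼-class of p is the set of types
-- containing all U · ψ, so by compactness an invariant open set around p
-- contains all types containing a single U · ψ; this yields the continuity
-- statements.

module Submission where

open import Defs
open import Level using (Level; Lift; lower) renaming (suc to lsuc)
open import Algebra.Bundles using (Group)
import Algebra.Properties.Group as GroupProperties
open import Axiom.ExcludedMiddle using (ExcludedMiddle)
open import Data.Empty using (⊥-elim)
open import Data.Fin using (_↑ˡ_)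
open import Data.List using (List; []; _∷_; foldr)
open import Data.List.Relation.Unary.All using (All; []; _∷_)
import Data.List.Relation.Unary.All as All
open import Data.List.Relation.Unary.Any using (Any; here; there)
open import Data.Product using (∃; ∃₂; _×_; _,_; proj₁; proj₂; uncurry)
open import Data.Sum using (_⊎_; inj₁; inj₂)
open import Data.Vec using (Vec; []; map; tabulate; _++_)
open import Data.Vec.Properties using (lookup-++ˡ)
open import Function using (id; _∘_; _⇔_; mk⇔; Equivalence)
open import Relation.Binary using (Setoid)
open import Relation.Binary.PropositionalEquality using (_≡_; refl; sym; trans; subst)
open import Relation.Nullary using (¬_; yes; no)
open import Relation.Nullary.Decidable using (True; toWitness; fromWitness; decidable-stable)
open import Relation.Unary using (Pred; _∈_; _⊆_)

open Equivalence using (to; from)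
open Topology using (Open)

private variable
  a c c′ e e′ o : Level

-- Local criteria for openness.

module _ {X : Setoid c e} (τ : Topology X o) where

  -- The family of all open subsets of `W` serves: by hypothesis its union is `W`.
  locally-open : ∀ {W} →
    (∀ {x} → x ∈ W → ∃ λ V → Open τ V × x ∈ V × V ⊆ W) → Open τ W
  locally-open {W} h = Topology.open-⋃ τ (λ V → Open τ V × V ⊆ W) proj₁
    ( (λ x∈W → let V , oV , x∈V , V⊆W = h x∈W in (V , oV , V⊆W) , x∈V)
    , λ ((_ , _ , V⊆W) , x∈V) → V⊆W x∈V )

module _ {X : Setoid c e} {Y : Setoid c′ e′}
         (σ : Topology X o) (τ : Topology Y o)
         {W : Pred (Setoid.Carrier X × Setoid.Carrier Y) o}
         (oW : Open (σ ×ᵗ τ) W) where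

  section-openˡ : ∀ y → Open σ (λ x → W (x , y))
  section-openˡ y = locally-open σ λ w →
    let A , _ , oA , _ , (x∈A , y∈B) , sub = proj₂ oW w
    in A , oA , x∈A , λ x′∈A → sub (x′∈A , y∈B)

  section-openʳ : ∀ x → Open τ (λ y → W (x , y))
  section-openʳ x = locally-open τ λ w →
    let _ , B , _ , oB , (x∈A , y∈B) , sub = proj₂ oW w
    in B , oB , y∈B , λ y′∈B → sub (x∈A , y′∈B)

module Proof (em : ∀ {a} → ExcludedMiddle a)
  {ℓ : Level} {L : Language ℓ} {𝓜 : Structure L}
  (𝓖 : DefinableTopologicalGroup 𝓜)
  (𝓔 : ElementaryExtension 𝓜) (saturated : ElementaryExtension.Saturated 𝓔)
  where

  open DefinableTopologicalGroup 𝓖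
  open ElementaryExtension 𝓔
  open Types definableGroup
  open S_G using (formulas; consistent; complete; γ∈; entails)
  open μTypes 𝓖 𝓔

  private
    grp : Group ℓ ℓ
    grp = record { isGroup = isGroup }

  open Group grp
    using (assoc; ∙-congˡ; ∙-congʳ; identityˡ; identityʳ; inverseʳ)
    renaming (sym to ≈-sym; trans to ≈-trans)
  open GroupProperties grp using (ε⁻¹≈ε; \\-leftDividesʳ; //-rightDividesˡ)

  -- Excluded middle makes every proposition decidable, hence equivalent to
  -- one at level ℓ.
  Resize : Set a → Set ℓ
  Resize P = Lift ℓ (True (em {P = P}))

  resize : {P : Set a} → P → Resize P
  resize p = Level.lift (fromWitness p)

  unresize : {P : Set a} → Resize P → P
  unresize r = toWitness (lower r)

  by-contradiction : {P : Set a} → ¬ ¬ P → P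
  by-contradiction = decidable-stable em

  -- Products of definable sets

  ⟪⟫-resp : ∀ φ {x y : G} → x ≈ y → x ∈ ⟪ φ ⟫ → y ∈ ⟪ φ ⟫
  ⟪⟫-resp φ = subst (𝓜 ⊨ φ)

  ∈-· : ∀ φ ψ {x y z : G} → x ∈ ⟪ φ ⟫ → y ∈ ⟪ ψ ⟫ → x ∙ y ≈ z → z ∈ ⟪ φ · ψ ⟫
  ∈-· φ ψ x∈ y∈ eq = from (sat-· φ ψ _) (_ , _ , x∈ , y∈ , eq)

  ·-IsGFormula : ∀ φ ψ → IsGFormula (φ · ψ)
  ·-IsGFormula φ ψ s =
    let x , y , _ , _ , eq = to (sat-· φ ψ _) s
    in subst (𝓜 ⊨ γ) eq (proj₂ (x ∙ y))

  ·-mono : ∀ φ ψ φ′ ψ′ → ⟪ φ ⟫ ⊆ ⟪ φ′ ⟫ → ⟪ ψ ⟫ ⊆ ⟪ ψ′ ⟫ →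
           (𝓜 ⊨ φ · ψ) ⊆ (𝓜 ⊨ φ′ · ψ′)
  ·-mono φ ψ φ′ ψ′ φ⊆ ψ⊆ s =
    let x , y , x∈ , y∈ , eq = to (sat-· φ ψ _) s
    in from (sat-· φ′ ψ′ _) (x , y , φ⊆ {x} x∈ , ψ⊆ {y} y∈ , eq)

  -- Applied to a `φ` obtained by `μ-halve`, so that two small factors are absorbed into one larger
  -- neighbourhood.
  ·-assoc-⊆ : ∀ φ ψ χ → (∀ {x y} → x ∈ ⟪ φ ⟫ → y ∈ ⟪ φ ⟫ → x ∙ y ∈ ⟪ χ ⟫) →
              (𝓜 ⊨ φ · (φ · ψ)) ⊆ (𝓜 ⊨ χ · ψ)
  ·-assoc-⊆ φ ψ χ h {v} s =
    let x , w , x∈ , w∈ , eq    = to (sat-· φ (φ · ψ) v) s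
        y , z , y∈ , z∈ , eq′   = to (sat-· φ ψ (proj₁ w)) w∈
    in from (sat-· χ ψ v)
         (x ∙ y , z , h x∈ y∈ , z∈ ,
          ≈-trans {x ∙ y ∙ z} {x ∙ w} {v , subst (𝓜 ⊨ γ) eq (proj₂ (x ∙ w))}
            (≈-trans {x ∙ y ∙ z} {x ∙ (y ∙ z)} {x ∙ w} (assoc x y z)
              (∙-congˡ {x} {y ∙ z} {w} eq′)) eq)

  -- Neighbourhoods of the identity

  μ-basis : ∀ {V} → Open topology V → ε ∈ V → ∃ λ U → μ U × ⟪ U ⟫ ⊆ V
  μ-basis oV ε∈V = let U , isG , oU , ε∈U , U⊆V = definable-basis oV ε∈V
                   in U , (isG , oU , ε∈U) , U⊆V

  μ-whole : ∃ μ
  μ-whole = let U , μU , _ = μ-basis (Topology.open-whole topology) _ in U , μU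

  μ-∩ : ∀ U V → μ U → μ V → μ (U ∧′ V)
  μ-∩ _ _ (isG , oU , ε∈U) (_ , oV , ε∈V) =
    isG ∘ proj₁ , Topology.open-∩ topology oU oV , ε∈U , ε∈V

  ∙-near : ∀ {V x y} → Open topology V → x ∙ y ∈ V → ∃₂ λ A B →
    Open topology A × Open topology B × (x ∈ A × y ∈ B) ×
    (∀ {x′ y′} → x′ ∈ A → y′ ∈ B → x′ ∙ y′ ∈ V)
  ∙-near oV xy∈V =
    let A , B , oA , oB , xy∈ , sub = proj₂ (IsContinuous.preimage-open ∙-continuous oV) xy∈V
    in A , B , oA , oB , xy∈ , λ x′∈ y′∈ → sub (x′∈ , y′∈)

  ∙ˡ-open : ∀ {V} g → Open topology V → Open topology (V ∘ (g ∙_))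
  ∙ˡ-open g oV = section-openʳ topology topology (IsContinuous.preimage-open ∙-continuous oV) g

  ∙ʳ-open : ∀ {V} g → Open topology V → Open topology (V ∘ (_∙ g))
  ∙ʳ-open g oV = section-openˡ topology topology (IsContinuous.preimage-open ∙-continuous oV) g

  -- Continuity of multiplication at `(ε , ε)` gives `A` and `B`; cutting `A` down by its inverse
  -- lets a single `V` control both products.
  μ-halve : ∀ U → μ U → ∃ λ V → μ V ×
    (∀ {x y} → x ∈ ⟪ V ⟫ → y ∈ ⟪ V ⟫ → x ∙ y ∈ ⟪ U ⟫ × (x ⁻¹) ∙ y ∈ ⟪ U ⟫)
  μ-halve U (_ , oU , ε∈U) =
    let A , B , oA , oB , (ε∈A , ε∈B) , sub =
          ∙-near oU (⟪⟫-resp U {ε} {ε ∙ ε} (≈-sym {ε ∙ ε} {ε} (identityˡ ε)) ε∈U)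
        oA⁻¹ = IsContinuous.preimage-open ⁻¹-continuous oA
        ε∈A⁻¹ = Topology.open-respects topology oA (≈-sym {ε ⁻¹} {ε} ε⁻¹≈ε) ε∈A
        V , μV , V⊆ = μ-basis
          (Topology.open-∩ topology oA (Topology.open-∩ topology oA⁻¹ oB))
          (ε∈A , ε∈A⁻¹ , ε∈B)
    in V , μV , λ x∈ y∈ →
         sub (proj₁ (V⊆ x∈)) (proj₂ (proj₂ (V⊆ y∈))) ,
         sub (proj₁ (proj₂ (V⊆ x∈))) (proj₂ (proj₂ (V⊆ y∈)))

  μ-near : ∀ {V g} → Open topology V → g ∈ V →
    ∃₂ λ U ψ → μ U × g ∈ ⟪ ψ ⟫ × ⟪ U · ψ ⟫ ⊆ V
  μ-near {V} {g} oV g∈V =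
    let A , B , oA , oB , (ε∈A , g∈B) , sub = ∙-near oV
          (Topology.open-respects topology oV (≈-sym {ε ∙ g} {g} (identityˡ g)) g∈V)
        U , μU , U⊆A = μ-basis oA ε∈A
        ψ , _ , _ , g∈ψ , ψ⊆B = definable-basis oB g∈B
    in U , ψ , μU , g∈ψ , λ s →
         let x , y , x∈ , y∈ , eq = to (sat-· U ψ _) s
         in Topology.open-respects topology oV eq (sub (U⊆A x∈) (ψ⊆B y∈))

  -- Types and saturation

  ∈-mono : ∀ p {φ ψ} → ⟪ φ ⟫ ⊆ ⟪ ψ ⟫ → φ ∈ formulas p → ψ ∈ formulas p
  ∈-mono p φ⊆ψ φ∈ = entails p (φ∈ ∷ γ∈ p ∷ []) λ { v (s ∷ v∈G ∷ []) → φ⊆ψ {v , v∈G} s }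

  ∈-∧ : ∀ p {φ ψ} → φ ∈ formulas p → ψ ∈ formulas p → (φ ∧′ ψ) ∈ formulas p
  ∈-∧ p φ∈ ψ∈ = entails p (φ∈ ∷ ψ∈ ∷ []) λ { _ (s ∷ t ∷ []) → s , t }

  ∈-¬ : ∀ p {φ} → ¬ φ ∈ formulas p → (¬′ φ) ∈ formulas p
  ∈-¬ p {φ} φ∉ with complete p φ
  ... | inj₁ φ∈  = ⊥-elim (φ∉ φ∈)
  ... | inj₂ ¬φ∈ = ¬φ∈

  ∈⇒¬∉ : ∀ p {φ} → φ ∈ formulas p → ¬ (¬′ φ) ∈ formulas p
  ∈⇒¬∉ p φ∈ ¬φ∈ with _ , s ∷ ¬s ∷ [] ← consistent p (φ∈ ∷ ¬φ∈ ∷ []) = ¬s s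

  ∈-satisfiable : ∀ p {φ} → φ ∈ formulas p → ∃ λ x → x ∈ ⟪ φ ⟫
  ∈-satisfiable p φ∈ with v , s ∷ v∈G ∷ [] ← consistent p (φ∈ ∷ γ∈ p ∷ []) =
    (v , v∈G) , s


  ·-∈ : ∀ p {U ψ} → μ U → ψ ∈ formulas p → U · ψ ∈ formulas p
  ·-∈ p {U} {ψ} (_ , _ , ε∈U) = ∈-mono p λ {x} s → ∈-· U ψ {ε} {x} {x} ε∈U s (identityˡ x)

  -- Quantifying away all variables of `φ` leaves a sentence, to which elementarity applies at the
  -- empty tuple.
  ∃-transfer : ∀ {n} (φ : Formulaᴹ 𝓜 n) → ∃ (⊨ᵁ φ) → ∃ (𝓜 ⊨ φ)
  ∃-transfer {n} φ (v , s) =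
    let w , t = to (sat-∃^ 𝓜 id n (φ [ σ ]) [])
          (from (elementary (∃^ n (φ [ σ ])) [])
            (from (sat-∃^ 𝓤 embed n (φ [ σ ]) [])
              (v , from (sat-[] 𝓤 embed φ σ (v ++ []))
                     (subst (⊨ᵁ φ) (sym (evals-σ 𝓤 embed v)) s))))
    in w , subst (𝓜 ⊨ φ) (evals-σ 𝓜 id w) (to (sat-[] 𝓜 id φ σ (w ++ [])) t)
    where
    -- ∃^ expects a context of the form n + 0.
    σ : Vec (Term L (Structure.Universe 𝓜) _) n
    σ = tabulate λ i → var (i ↑ˡ 0)
    evals-σ : ∀ (𝓝 : Structure L) ι (v : Vec (Structure.Universe 𝓝) n) →
              evals 𝓝 ι σ (v ++ []) ≡ v
    evals-σ 𝓝 ι v = evals-vars 𝓝 ι (_↑ˡ 0) (v ++ []) v (lookup-++ˡ v [])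

  -- A counterexample in `𝓤` would transfer to one in `𝓜`.
  ⊆-transfer : ∀ (φ ψ : Formulaᴹ 𝓜 dim) → (𝓜 ⊨ φ) ⊆ (𝓜 ⊨ ψ) → ⊨ᵁ φ ⊆ ⊨ᵁ ψ
  ⊆-transfer φ ψ φ⊆ψ {v} s = by-contradiction λ ¬t →
    let w , s′ , ¬t′ = ∃-transfer (φ ∧′ ¬′ ψ) (v , s , ¬t) in ¬t′ (φ⊆ψ s′)

  -- The empty conjunction is `γ`, which holds of every tuple considered here.
  ⋀ : List (Formulaᴹ 𝓜 dim) → Formulaᴹ 𝓜 dim
  ⋀ = foldr _∧′_ γ

  tpᵁ : (v : Vec (Structure.Universe 𝓤) dim) → ⊨ᵁ γ v → S_G
  tpᵁ v v∈G = record
    { formulas   = λ φ → ⊨ᵁ φ v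
    ; consistent = λ {φs} s →
        let w , t = ∃-transfer (⋀ φs) (v , ⋀-intro s) in w , ⋀-elim φs t
    ; complete   = decide
    ; γ∈         = v∈G
    }
    where
    ⋀-intro : ∀ {φs} → All (λ φ → ⊨ᵁ φ v) φs → ⊨ᵁ (⋀ φs) v
    ⋀-intro []      = v∈G
    ⋀-intro (s ∷ t) = s , ⋀-intro t
    ⋀-elim : ∀ φs {w} → (𝓜 ⊨ ⋀ φs) w → All (λ φ → (𝓜 ⊨ φ) w) φs
    ⋀-elim []       _       = []
    ⋀-elim (_ ∷ φs) (s , t) = s ∷ ⋀-elim φs t
    decide : ∀ φ → ⊨ᵁ φ v ⊎ ⊨ᵁ (¬′ φ) v
    decide φ with em {P = ⊨ᵁ φ v}
    ... | yes s = inj₁ s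
    ... | no ¬s = inj₂ ¬s

  realize : {Φ : Pred (Formulaᴹ 𝓜 dim) ℓ} →
    (∀ {φs} → All Φ φs → ∃ λ r → All (_∈ formulas r) φs) → ∃ λ v → Realizes v Φ
  realize {Φ} h = saturated Φ λ φs φs∈ →
    let r , φs∈r = h φs∈
        v , s    = consistent r φs∈r
    in map embed v , All.map (λ {φ} → to (elementary φ v)) s

  -- Compactness of the type space, derived from saturation: the type of a realization of `Φ` in `𝓤`
  -- contains `Φ`.
  types-compact : (Φ : Pred (Formulaᴹ 𝓜 dim) a) →
    (∀ {φs} → All Φ φs → ∃ λ r → All (_∈ formulas r) φs) → ∃ λ r → Φ ⊆ formulas r
  types-compact {a} Φ h = tpᵁ v (v⊨ (resize (inj₂ refl))) , λ φ∈ → v⊨ (resize (inj₁ φ∈))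
    where
    -- Resizing brings `Φ` to the level that saturation accepts; adjoining `γ` forces the
    -- realization into the group.
    Φ∪γ : Pred (Formulaᴹ 𝓜 dim) ℓ
    Φ∪γ φ = Resize (φ ∈ Φ ⊎ φ ≡ γ)
    drop-γ : ∀ {φs} → All Φ∪γ φs → ∃ λ φs₀ → All Φ φs₀ ×
      (∀ r → All (_∈ formulas r) φs₀ → All (_∈ formulas r) φs)
    drop-γ [] = [] , [] , λ _ _ → []
    drop-γ (φ∈ ∷ φs∈) with unresize φ∈ | drop-γ φs∈
    ... | inj₁ φ∈Φ  | φs₀ , φs₀∈ , k = _ , φ∈Φ ∷ φs₀∈ , λ { r (s ∷ t) → s ∷ k r t }
    ... | inj₂ refl | φs₀ , φs₀∈ , k = φs₀ , φs₀∈ , λ r t → γ∈ r ∷ k r t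
    realization : ∃ λ v → Realizes v Φ∪γ
    realization = realize λ φs∈ →
      let _ , φs₀∈ , k = drop-γ φs∈
          r , φs₀∈r    = h φs₀∈
      in r , k r φs₀∈r
    v  = proj₁ realization
    v⊨ : Realizes v Φ∪γ
    v⊨ = proj₂ realization

  realization : ∀ p → ∃ λ v → Realizes v (formulas p)
  realization p = realize λ φs∈ → p , φs∈

  ⊢⇒∈ : ∀ p {ψ} → formulas p ⊢ ψ → ψ ∈ formulas p
  ⊢⇒∈ p {ψ} p⊢ψ with complete p ψ | realization p
  ... | inj₁ ψ∈  | _      = ψ∈
  ... | inj₂ ¬ψ∈ | v , v⊨ = ⊥-elim (v⊨ ¬ψ∈ (p⊢ψ v v⊨))

  -- If no neighbourhood lay inside `φ`, each would contain a point outside `φ`. Since `μ` is closed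
  -- under finite intersections, compactness would then realize `μ` together with `¬′ φ`.
  μ⊢⇒⊇ : ∀ φ → μ ⊢ φ → ∃ λ U → μ U × ⟪ U ⟫ ⊆ ⟪ φ ⟫
  μ⊢⇒⊇ φ μ⊢φ = by-contradiction λ none →
    let r , Φ⊆r = types-compact Φ λ φs∈ →
          let U , μU , k = bound φs∈
              x , x∈U , x∉φ = by-contradiction λ ¬∃ →
                none (U , μU , λ {x} x∈U → by-contradiction λ x∉φ → ¬∃ (x , x∈U , x∉φ))
          in tp em x , k x x∈U x∉φ
        v , v⊨ = realization r
    in v⊨ {¬′ φ} (Φ⊆r (inj₂ refl)) (μ⊢φ v λ {U} μU → v⊨ {U} (Φ⊆r {U} (inj₁ μU)))
    where
    Φ : Pred (Formulaᴹ 𝓜 dim) (lsuc ℓ)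
    Φ χ = μ χ ⊎ χ ≡ ¬′ φ
    bound : ∀ {φs} → All Φ φs → ∃ λ U → μ U ×
      (∀ x → x ∈ ⟪ U ⟫ → ¬ x ∈ ⟪ φ ⟫ → All (λ χ → x ∈ ⟪ χ ⟫) φs)
    bound [] = let U , μU = μ-whole in U , μU , λ _ _ _ → []
    bound {V ∷ _} (inj₁ μV ∷ φs∈) =
      let U , μU , k = bound φs∈
      in V ∧′ U , μ-∩ V U μV μU , λ x (x∈V , x∈U) x∉φ → x∈V ∷ k x x∈U x∉φ
    bound (inj₂ refl ∷ φs∈) =
      let U , μU , k = bound φs∈
      in U , μU , λ x x∈U x∉φ → x∉φ ∷ k x x∈U x∉φ

  -- The equivalence ∼ without reference to 𝓤

  infix 4 _≲_
  _≲_ : S_G → S_G → Set (lsuc ℓ)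
  p ≲ q = ∀ {U ψ} → μ U → ψ ∈ formulas p → U · ψ ∈ formulas q

  -- With `≲⇒∼`, this reduces equivalence of two types to a single inclusion.
  ⊆⇒≲ : ∀ p q → formulas p ⊆ formulas q → p ≲ q
  ⊆⇒≲ p q p⊆q μU ψ∈ = ·-∈ q μU (p⊆q ψ∈)

  -- If U · θ ∉ p, then V · ¬(U · θ) ∈ q for small V, so v ∙ y ∈ θ for some
  -- v ∈ V and y ∉ U · θ; but y = v⁻¹ ∙ (v ∙ y).
  ≲-sym : ∀ p q → p ≲ q → q ≲ p
  ≲-sym p q p≲q {U} {θ} μU θ∈ = by-contradiction λ Uθ∉ →
    let V , μV@(_ , _ , ε∈V) , halve = μ-halve U μU
        z , sV , z∈θ = ∈-satisfiable q {(V · (¬′ (U · θ))) ∧′ θ}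
          (∈-∧ q (p≲q {V} {¬′ (U · θ)} μV (∈-¬ p Uθ∉)) θ∈)
        x , y , x∈V , y∉Uθ , eq = to (sat-· V (¬′ (U · θ)) (proj₁ z)) sV
        x⁻¹∈U = ⟪⟫-resp U {(x ⁻¹) ∙ ε} {x ⁻¹} (identityʳ (x ⁻¹)) (proj₂ (halve {x} {ε} x∈V ε∈V))
    in y∉Uθ (∈-· U θ {x ⁻¹} {z} {y} x⁻¹∈U z∈θ
         (≈-trans {(x ⁻¹) ∙ z} {(x ⁻¹) ∙ (x ∙ y)} {y}
           (∙-congˡ {x ⁻¹} {z} {x ∙ y} (sym eq)) (\\-leftDividesʳ x y)))

  -- A realization of `q` realizes `μ· q`, because the neighbourhoods contain `ε`; hence it realizes
  -- `μ· p`, which includes a formula implying `U · ψ`.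
  ∼⇒≲ : ∀ {p q} → p ∼ q → p ≲ q
  ∼⇒≲ {p} {q} p∼q {U} {ψ} μU@(isG , _ , _) ψ∈ = ⊢⇒∈ q λ v v⊨ →
    ⊆-transfer (U · ψ′) (U · ψ) (·-mono U ψ′ U ψ id proj₂)
      (from (p∼q v)
        (λ { (φ , χ , _ , _ , μ⊢φ , q⊢χ , refl) →
          v⊨ (mono-⊢ φ χ μ⊢φ (⊢⇒∈ q q⊢χ)) })
        (U , ψ′ , isG , proj₁ , (λ w w⊨ → w⊨ {U} μU) ,
         (λ w w⊨ → w⊨ {γ} (γ∈ p) , w⊨ {ψ} ψ∈) , refl))
    where
    -- Only G-formulas enter `μ· p`, so `ψ` is first cut down to the group.
    ψ′ = γ ∧′ ψ
    mono-⊢ : ∀ φ χ → μ ⊢ φ → χ ∈ formulas q → φ · χ ∈ formulas q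
    mono-⊢ φ χ μ⊢φ χ∈ =
      let V , μV , V⊆φ = μ⊢⇒⊇ φ μ⊢φ
      in ∈-mono q (·-mono V χ φ χ (λ {x} → V⊆φ {x}) id) (·-∈ q μV χ∈)

  -- For `φ · ψ` in `μ· p`, halve a neighbourhood inside `φ` to get `V`. Then `V · ψ` lies in `q`,
  -- so `V · (V · ψ)` is in `μ· q` and implies `φ · ψ`.
  ≲⇒∼ : ∀ {p q} → p ≲ q → p ∼ q
  ≲⇒∼ {p} {q} p≲q v = mk⇔ (realizes q p (≲-sym p q p≲q)) (realizes p q p≲q)
    where
    realizes : ∀ p q → p ≲ q → Realizes v (μ· q) → Realizes v (μ· p)
    realizes p q p≲q v⊨ (φ , ψ , _ , _ , μ⊢φ , p⊢ψ , refl) =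
      let U , μU , U⊆φ = μ⊢⇒⊇ φ μ⊢φ
          V , μV@(isG , _) , halve = μ-halve U μU
          Vψ∈q = p≲q {V} {ψ} μV (⊢⇒∈ p p⊢ψ)
      in ⊆-transfer (V · (V · ψ)) (φ · ψ)
           (λ s → ·-mono U ψ φ ψ (λ {x} → U⊆φ {x}) id
             (·-assoc-⊆ V ψ U (λ {x} {y} x∈ y∈ → proj₁ (halve {x} {y} x∈ y∈)) s))
           (v⊨ (V , V · ψ , isG , ·-IsGFormula V ψ ,
                (λ w w⊨ → w⊨ {V} μV) , (λ w w⊨ → w⊨ {V · ψ} Vψ∈q) , refl))

  -- Open sets of μ-types

  Contains : Pred G ℓ → S_G → Set (lsuc ℓ)
  Contains V p = ∃₂ λ U ψ → μ U × ψ ∈ formulas p × ⟪ U · ψ ⟫ ⊆ V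

  -- Resized because open sets are predicates at level `ℓ`, while `Contains` quantifies over `μ` one
  -- level higher.
  O : Pred G ℓ → Pred S_G ℓ
  O V p = Resize (Contains V p)

  O-intro : ∀ p {U ψ} → μ U → ψ ∈ formulas p → p ∈ O ⟪ U · ψ ⟫
  O-intro p {U} {ψ} μU ψ∈ = resize {P = Contains ⟪ U · ψ ⟫ p} (U , ψ , μU , ψ∈ , id)

  -- Invariance: passing to an equivalent type costs one neighbourhood factor, which halving `U`
  -- provides. Openness: the formula `ψ` already witnesses membership.
  O-open : ∀ V → Open Sᵘ-topology (O V)
  O-open V =
    (λ {p} {q} p∼q p∈O →
      let U , ψ , μU , ψ∈ , Uψ⊆V = unresize {P = Contains V p} p∈O
          W , μW , halve = μ-halve U μU
      in resize {P = Contains V q} (W , W · ψ , μW , ∼⇒≲ {p} {q} p∼q {W} {ψ} μW ψ∈ , λ {x} s →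
           Uψ⊆V {x} (·-assoc-⊆ W ψ U (λ {x} {y} x∈ y∈ → proj₁ (halve {x} {y} x∈ y∈)) s))) ,
    λ {p} p∈O →
      let U , ψ , μU , ψ∈ , Uψ⊆V = unresize {P = Contains V p} p∈O
      in ψ , ψ∈ , λ {r} ψ∈r → resize {P = Contains V r} (U , ψ , μU , ψ∈r , λ {x} → Uψ⊆V {x})

  O-∋ : ∀ {V p} → p ∈ O V → ∃ λ φ → φ ∈ formulas p × ⟪ φ ⟫ ⊆ V
  O-∋ {V} {p} p∈O = let U , ψ , μU , ψ∈ , Uψ⊆V = unresize {P = Contains V p} p∈O
                    in U · ψ , ·-∈ p μU ψ∈ , Uψ⊆V

  -- The ∼-class of p is the closed set of types containing all U · ψ, so
  -- compactness bounds an invariant open set around it from below.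
  Sᵘ-basis : ∀ {V p} → Open Sᵘ-topology V → p ∈ V →
    ∃₂ λ U ψ → μ U × ψ ∈ formulas p × (∀ r → U · ψ ∈ formulas r → r ∈ V)
  Sᵘ-basis {V} {p} (inv , oV) p∈V = by-contradiction λ none →
    let r , Φ⊆r = types-compact Φ λ φs∈ →
          let U , ψ , μU , ψ∈ , k = bound φs∈
              r , Uψ∈r , r∉V = by-contradiction λ ¬∃ →
                none (U , ψ , μU , ψ∈ , λ r Uψ∈r → by-contradiction λ r∉V → ¬∃ (r , Uψ∈r , r∉V))
          in r , k r Uψ∈r r∉V
        θ , θ∈r , θ⊆V = oV {r} (inv {p} {r}
          (≲⇒∼ {p} {r} λ μU ψ∈ → Φ⊆r (inj₁ (_ , _ , μU , ψ∈ , refl))) p∈V)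
    in ∈⇒¬∉ r {θ} θ∈r (Φ⊆r (inj₂ (θ , θ⊆V , refl)))
    where
    Φ : Pred (Formulaᴹ 𝓜 dim) (lsuc ℓ)
    Φ χ = (∃₂ λ U ψ → μ U × ψ ∈ formulas p × χ ≡ U · ψ) ⊎
          -- Since `V` is open, a type containing all these negations lies outside `V`.
          (∃ λ θ → (λ q → θ ∈ formulas q) ⊆ V × χ ≡ ¬′ θ)
    bound : ∀ {φs} → All Φ φs → ∃₂ λ U ψ → μ U × ψ ∈ formulas p ×
      (∀ r → U · ψ ∈ formulas r → ¬ r ∈ V → All (_∈ formulas r) φs)
    bound [] = let U , μU = μ-whole in U , γ , μU , γ∈ p , λ _ _ _ → []
    bound (inj₁ (U , ψ , μU , ψ∈ , refl) ∷ φs∈) =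
      let U′ , ψ′ , μU′ , ψ′∈ , k = bound φs∈
      in U ∧′ U′ , ψ ∧′ ψ′ , μ-∩ U U′ μU μU′ , ∈-∧ p ψ∈ ψ′∈ , λ r s r∉V →
           ∈-mono r (·-mono (U ∧′ U′) (ψ ∧′ ψ′) U ψ proj₁ proj₁) s ∷
           k r (∈-mono r (·-mono (U ∧′ U′) (ψ ∧′ ψ′) U′ ψ′ proj₂ proj₂) s) r∉V
    bound (inj₂ (θ , θ⊆V , refl) ∷ φs∈) =
      let U , ψ , μU , ψ∈ , k = bound φs∈
      in U , ψ , μU , ψ∈ , λ r s r∉V → ∈-¬ r (r∉V ∘ θ⊆V {r}) ∷ k r s r∉V

  -- Compactness and separation.

  -- Without a finite subcover, the negations of all formulas whose basic sets lie inside members of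
  -- `F` are jointly consistent; a type containing them would be covered by no member.
  Sᵘ-compact : Compact Sᵘ-topology
  Sᵘ-compact F F⊆ cover = by-contradiction λ none →
    let r , Φ⊆r = types-compact Φ λ φs∈ →
          let Vs , Vs∈ , k = select φs∈
              r , r∉ = by-contradiction λ ¬∃ →
                none (Vs , Vs∈ , λ r → by-contradiction λ r∉ → ¬∃ (r , r∉))
          in r , k r r∉
        (V , FV) , r∈V = cover r
        θ , θ∈r , θ⊆V = proj₂ (F⊆ FV) {r} r∈V
    in ∈⇒¬∉ r {θ} θ∈r (Φ⊆r (V , θ , FV , θ⊆V , refl))
    where
    Φ : Pred (Formulaᴹ 𝓜 dim) (lsuc ℓ)
    Φ χ = ∃₂ λ V θ → F V × (λ q → θ ∈ formulas q) ⊆ V × χ ≡ ¬′ θ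
    select : ∀ {φs} → All Φ φs → ∃ λ Vs → All F Vs ×
      (∀ r → ¬ Any (r ∈_) Vs → All (_∈ formulas r) φs)
    select [] = [] , [] , λ _ _ → []
    select ((V , θ , FV , θ⊆V , refl) ∷ φs∈) =
      let Vs , Vs∈ , k = select φs∈
      in V ∷ Vs , FV ∷ Vs∈ , λ r r∉ →
           ∈-¬ r (r∉ ∘ here ∘ θ⊆V {r}) ∷ k r (r∉ ∘ there)

  Sᵘ-hausdorff : Hausdorff Sᵘ-topology
  Sᵘ-hausdorff p q p≁q =
    let U , ψ , μU , ψ∈ , Uψ∉q = by-contradiction λ ¬∃ → p≁q (≲⇒∼ {p} {q} λ {U} {ψ} μU ψ∈ →
          by-contradiction λ Uψ∉q → ¬∃ (U , ψ , μU , ψ∈ , Uψ∉q))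
        V , μV , halve = μ-halve U μU
        N = ¬′ (U · ψ)
    in O ⟪ V · ψ ⟫ , O ⟪ V · N ⟫ , O-open _ , O-open _ ,
       O-intro p {V} {ψ} μV ψ∈ , O-intro q {V} {N} μV (∈-¬ q Uψ∉q) ,
       λ {r} (r∈ , r∈′) →
         let φ  , φ∈  , φ⊆  = O-∋ {p = r} r∈
             φ′ , φ′∈ , φ′⊆ = O-∋ {p = r} r∈′
             z , z∈φ , z∈φ′ = ∈-satisfiable r {φ ∧′ φ′} (∈-∧ r φ∈ φ′∈)
             x , y , x∈V , y∈ψ , xy≈z = to (sat-· V ψ (proj₁ z)) (φ⊆ {z} z∈φ)
             x′ , y′ , x′∈V , y′∈N , x′y′≈z = to (sat-· V N (proj₁ z)) (φ′⊆ {z} z∈φ′)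
         -- From `x ∙ y ≈ x′ ∙ y′` one gets `y′ ≈ ((x′ ⁻¹) ∙ x) ∙ y`, which puts `y′` in `U · ψ`.
         in y′∈N (∈-· U ψ {(x′ ⁻¹) ∙ x} {y} {y′} (proj₂ (halve {x′} {x} x′∈V x∈V)) y∈ψ
              (trans (assoc (x′ ⁻¹) x y)
                (trans (∙-congˡ {x′ ⁻¹} {x ∙ y} {x′ ∙ y′} (trans xy≈z (sym x′y′≈z)))
                  (\\-leftDividesʳ x′ y′))))

  -- The action

  ∈-▷ : ∀ p {φ ψ} g → (∀ {x} → x ∈ ⟪ φ ⟫ → g ∙ x ∈ ⟪ ψ ⟫) →
        φ ∈ formulas p → ψ ∈ formulas (g ▷ p)
  ∈-▷ p {φ} {ψ} g h = ∈-mono p λ {x} s → from (sat-∙x ψ g (proj₁ x) (proj₂ x)) (h {x} s)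

  ∙x-elim : ∀ φ g {x} → x ∈ ⟪ φ ⟨ g ∙x⟩ ⟫ → g ∙ x ∈ ⟪ φ ⟫
  ∙x-elim φ g {x} = to (sat-∙x φ g (proj₁ x) (proj₂ x))

  ▷-congˡ : ∀ {p q} g → p ∼ q → (g ▷ p) ∼ (g ▷ q)
  ▷-congˡ {p} {q} g p∼q = ≲⇒∼ {g ▷ p} {g ▷ q} λ {U} {ψ} (_ , oU , ε∈U) ψ∈ →
    -- `W` is chosen with its conjugate by `g` inside `U`, since `g ∙ (x ∙ y)` equals
    -- `((g ∙ x) ∙ (g ⁻¹)) ∙ (g ∙ y)`.
    let W , μW , W⊆ = μ-basis (∙ˡ-open g (∙ʳ-open (g ⁻¹) oU))
          (⟪⟫-resp U {ε} {(g ∙ ε) ∙ (g ⁻¹)}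
            (sym (trans (∙-congʳ {g ⁻¹} {g ∙ ε} {g} (identityʳ g)) (inverseʳ g))) ε∈U)
    in ∈-▷ q {W · (ψ ⟨ g ∙x⟩)} {U · ψ} g
         (λ {z} s →
           let x , y , x∈ , y∈ , eq = to (sat-· W (ψ ⟨ g ∙x⟩) (proj₁ z)) s
           in ∈-· U ψ {(g ∙ x) ∙ (g ⁻¹)} {g ∙ y} {g ∙ z} (W⊆ {x} x∈) (∙x-elim ψ g {y} y∈)
                (trans (assoc (g ∙ x) (g ⁻¹) (g ∙ y))
                  (trans (∙-congˡ {g ∙ x} {(g ⁻¹) ∙ (g ∙ y)} {y} (\\-leftDividesʳ g y))
                    (trans (assoc g x y) (∙-congˡ {g} {x ∙ y} {z} eq)))))
         (∼⇒≲ {p} {q} p∼q {W} {ψ ⟨ g ∙x⟩} μW ψ∈)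

  ▷-congʳ : ∀ p {g h} → g ≈ h → (g ▷ p) ∼ (h ▷ p)
  ▷-congʳ p {g} {h} g≈h = ≲⇒∼ {g ▷ p} {h ▷ p} (⊆⇒≲ (g ▷ p) (h ▷ p) λ {φ} →
    ∈-▷ p {φ ⟨ g ∙x⟩} {φ} h λ {x} s →
      ⟪⟫-resp φ {g ∙ x} {h ∙ x} (∙-congʳ {x} {g} {h} g≈h) (∙x-elim φ g {x} s))

  module ∼ = Setoid Sᵘ

  ▷-continuous : IsContinuous (topology ×ᵗ Sᵘ-topology) Sᵘ-topology (uncurry _▷_)
  ▷-continuous = record
    { congruent     = λ {x} {y} → ▷-cong {x} {y}
    ; preimage-open = λ {V} oV → (λ {x} {y} eq → proj₁ oV (▷-cong {x} {y} eq)) , near {V} oV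
    }
    where
    ▷-cong : ∀ {x y} → proj₁ x ≈ proj₁ y × (proj₂ x ∼ proj₂ y) → uncurry _▷_ x ∼ uncurry _▷_ y
    ▷-cong {g , p} {h , q} (g≈h , p∼q) =
      ∼.trans {g ▷ p} {h ▷ p} {h ▷ q} (▷-congʳ p {g} {h} g≈h) (▷-congˡ {p} {q} h p∼q)
    near : ∀ {V} → Open Sᵘ-topology V → ∀ {z} → uncurry _▷_ z ∈ V →
      ∃₂ λ A B → Open topology A × Open Sᵘ-topology B × (proj₁ z ∈ A × proj₂ z ∈ B) ×
      (∀ {z′} → proj₁ z′ ∈ A × proj₂ z′ ∈ B → uncurry _▷_ z′ ∈ V)
    near {V} oV {g , p} gp∈V =
      let U , ψ , μU , ψ∈ , Uψ⊆V = Sᵘ-basis {V} {g ▷ p} oV gp∈V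
          W , μW@(_ , oW , ε∈W) , halve = μ-halve U μU
          inv , oO = O-open ⟪ W · ψ ⟫
      -- The box is the translate of `W` by `g` on the right, times the preimage of `O ⟪ W · ψ ⟫`
      -- under `g`. Writing `h ∙ z` as `(h ∙ (g ⁻¹)) ∙ (g ∙ z)` leaves two factors from `W` before
      -- `ψ`, and these fit into `U`.
      in (λ h → h ∙ (g ⁻¹) ∈ ⟪ W ⟫) , (λ q → g ▷ q ∈ O ⟪ W · ψ ⟫) ,
         ∙ʳ-open (g ⁻¹) oW ,
         ((λ {q} {r} q∼r → inv {g ▷ q} {g ▷ r} (▷-congˡ {q} {r} g q∼r)) ,
          λ {q} gq∈O → let θ , θ∈ , θ⊆ = oO {g ▷ q} gq∈O
                       in θ ⟨ g ∙x⟩ , θ∈ , λ {r} → θ⊆ {g ▷ r}) ,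
         (⟪⟫-resp W {ε} {g ∙ (g ⁻¹)} (sym (inverseʳ g)) ε∈W , O-intro (g ▷ p) {W} {ψ} μW ψ∈) ,
         λ { {h , q} (hg⁻¹∈W , gq∈O) →
           let φ , φ∈ , φ⊆ = O-∋ {p = g ▷ q} gq∈O
           in Uψ⊆V (h ▷ q) (∈-▷ q {φ ⟨ g ∙x⟩} {U · ψ} h
                (λ {z} s →
                  let x , y , x∈W , y∈ψ , eq =
                        to (sat-· W ψ (proj₁ (g ∙ z))) (φ⊆ {g ∙ z} (∙x-elim φ g {z} s))
                  in ∈-· U ψ {(h ∙ (g ⁻¹)) ∙ x} {y} {h ∙ z}
                       (proj₁ (halve {h ∙ (g ⁻¹)} {x} hg⁻¹∈W x∈W)) y∈ψ
                       (trans (assoc (h ∙ (g ⁻¹)) x y)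
                         (trans (∙-congˡ {h ∙ (g ⁻¹)} {x ∙ y} {g ∙ z} eq)
                           (trans (assoc h (g ⁻¹) (g ∙ z))
                             (∙-congˡ {h} {(g ⁻¹) ∙ (g ∙ z)} {z} (\\-leftDividesʳ g z))))))
                φ∈) }

  ▷-isContinuousAction : IsContinuousAction topology Sᵘ-topology _∙_ ε _▷_
  ▷-isContinuousAction = record
    { identity     = λ p → ≲⇒∼ {ε ▷ p} {p} (⊆⇒≲ (ε ▷ p) p λ {φ} →
        ∈-mono p {φ ⟨ ε ∙x⟩} {φ} λ {x} s →
          ⟪⟫-resp φ {ε ∙ x} {x} (identityˡ x) (∙x-elim φ ε {x} s))
    ; compatible   = λ g h p → ≲⇒∼ {(g ∙ h) ▷ p} {g ▷ (h ▷ p)}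
        (⊆⇒≲ ((g ∙ h) ▷ p) (g ▷ (h ▷ p)) λ {φ} →
          ∈-▷ p {φ ⟨ g ∙ h ∙x⟩} {φ ⟨ g ∙x⟩} h λ {x} s →
            from (sat-∙x φ g (proj₁ (h ∙ x)) (proj₂ (h ∙ x)))
              (⟪⟫-resp φ {(g ∙ h) ∙ x} {g ∙ (h ∙ x)} (assoc g h x) (∙x-elim φ (g ∙ h) {x} s)))
    ; isContinuous = ▷-continuous
    }

  -- The embedding

  tp-isContinuous : IsContinuous topology Sᵘ-topology (tp em)
  tp-isContinuous = record
    { congruent     = λ {g} {h} g≈h →
        ≲⇒∼ {tp em g} {tp em h} (⊆⇒≲ (tp em g) (tp em h) λ {φ} → ⟪⟫-resp φ {g} {h} g≈h)
    ; preimage-open = λ {V} oV → locally-open topology λ {g} g∈ →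
        let U , ψ , (_ , oU , ε∈U) , g∈ψ , Uψ⊆V = Sᵘ-basis {V} {tp em g} oV g∈
        -- For `h` in the translate of `U` by `g`, the factorization `(h ∙ (g ⁻¹)) ∙ g` places `h`
        -- in `U · ψ`.
        in (λ h → h ∙ (g ⁻¹) ∈ ⟪ U ⟫) , ∙ʳ-open (g ⁻¹) oU ,
           ⟪⟫-resp U {ε} {g ∙ (g ⁻¹)} (sym (inverseʳ g)) ε∈U ,
           λ {h} h∈ → Uψ⊆V (tp em h)
             (∈-· U ψ {h ∙ (g ⁻¹)} {g} {h} h∈ g∈ψ (//-rightDividesˡ g h))
    }

  -- Around `g`, some `U · ψ` fits inside a separating open set `A`; equivalence of the types would
  -- put `h` in it as well.
  tp-injective : ∀ {g h} → tp em g ∼ tp em h → g ≈ h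
  tp-injective {g} {h} eq = by-contradiction λ g≉h →
    let A , B , oA , oB , g∈A , h∈B , A⊥B = hausdorff g h g≉h
        U , ψ , μU , g∈ψ , Uψ⊆A = μ-near oA g∈A
    in A⊥B {h} (Uψ⊆A {h} (∼⇒≲ {tp em g} {tp em h} eq {U} {ψ} μU g∈ψ) , h∈B)

  tp-inducing : ∀ {V} → Open topology V → ∀ g → g ∈ V ⇔ tp em g ∈ O V
  tp-inducing {V} oV g = mk⇔
    (λ g∈V → let U , ψ , μU , g∈ψ , Uψ⊆V = μ-near oV g∈V
             in resize {P = Contains V (tp em g)} (U , ψ , μU , g∈ψ , λ {x} → Uψ⊆V {x}))
    (λ g∈O → let φ , g∈φ , φ⊆V = O-∋ {V} {tp em g} g∈O in φ⊆V {g} g∈φ)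

  tp-isEmbedding : IsEmbedding topology Sᵘ-topology (tp em)
  tp-isEmbedding = record
    { isContinuous = tp-isContinuous
    ; injective    = λ {g} {h} → tp-injective {g} {h}
    ; inducing     = λ {V} oV → O V , O-open V ,
        (λ {g} → to (tp-inducing oV g)) , (λ {g} → from (tp-inducing oV g))
    }

  -- Types are finitely satisfiable in `𝓜`, so every nonempty basic open set contains the type of a
  -- point of the group.
  tp-dense : HasDenseImage topology Sᵘ-topology (tp em)
  tp-dense (_ , oV) (p , p∈V) =
    let θ , θ∈ , θ⊆V = oV {p} p∈V
        g , g∈θ = ∈-satisfiable p θ∈
    in g , θ⊆V {tp em g} g∈θ

theorem1p2 :
    (em : ∀ {a} → ExcludedMiddle a) →
    ∀ {ℓ : Level} {L : Language ℓ} {𝓜 : Structure L}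
    (𝓖 : DefinableTopologicalGroup 𝓜)
    (𝓔 : ElementaryExtension 𝓜) → ElementaryExtension.Saturated 𝓔 →
    let open DefinableTopologicalGroup 𝓖
        open Types definableGroup
        open μTypes 𝓖 𝓔
    in Compact Sᵘ-topology
     × Hausdorff Sᵘ-topology
     × IsContinuousAction topology Sᵘ-topology _∙_ ε _▷_
     × IsEmbedding topology Sᵘ-topology (tp em)
     × HasDenseImage topology Sᵘ-topology (tp em)
theorem1p2 em 𝓖 𝓔 saturated =
  Sᵘ-compact , Sᵘ-hausdorff , ▷-isContinuousAction , tp-isEmbedding , tp-dense
  where open Proof em 𝓖 𝓔 saturated
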